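{- Let $\mathcal{K}$ be a finite class of similar finite smooth idempotent algebras and $\mathbb{A}\in\mathcal{K}$. For any majority edge $ab$ of $\mathbb{A}$, where $\theta$ is a witnessing congruence of $\mathsf{Sg}\{a,b\}$, and any $c\in a/\theta$ there is $d\in b/\theta$ such that $cd$ is a special thin majority edge.
   Context: $\mathsf{Sg}\{a,b\}$ is the subalgebra generated by $a,b$. For a congruence $\theta$ of $\mathsf{Sg}\{a,b\}$, $a/\theta$ is the $\theta$-block of $a$ and $f/\theta$ the operation induced by $f$ on the quotient. For an idempotent algebra, a pair $ab$ of distinct elements is a semilattice edge witnessed by a congruence $\theta$ of $\mathsf{Sg}\{a,b\}$ with $a/\theta\ne b/\theta$ if some binary term operation induces a semilattice operation on $\{a/\theta,b/\theta\}$; it is a majority edge witnessed by $\theta$ if some ternary term operation induces a majority operation on $\{a/\theta,b/\theta\}$ but no term operation induces a semilattice operation there. In each case $\{a/\theta,b/\theta\}$ is a thick edge of that type. An idempotent algebra is smooth if for every thick edge $\{a/\theta,b/\theta\}$ of semilattice or majority type the set $a/\theta\cup b/\theta$ is a subuniverse. A pair $ab$ is minimal with respect to a congruence $\theta$ of $\mathsf{Sg}\{a,b\}$ if for any $b'\in b/\theta$ we have $b\in\mathsf{Sg}\{a,b'\}$. A ternary term operation $g'$ satisfies the majority condition (with respect to $\mathcal{K}$) if $g'(x,g'(x,y,y),g'(x,y,y))=g'(x,y,y)$ holds in every algebra of $\mathcal{K}$ and $g'$ (via $g'/\theta$) is a majority operation on every thick majority edge of every algebra from $\mathcal{K}$.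 A pair $ab$ of distinct elements of $\mathbb{A}\in\mathcal{K}$ is a thin majority edge (with respect to $\mathcal{K}$) if for any term operation $g'$ satisfying the majority condition, each of $\mathsf{Sg}\{a,g'(a,b,b)\}$, $\mathsf{Sg}\{a,g'(b,a,b)\}$, $\mathsf{Sg}\{a,g'(b,b,a)\}$ contains $b$. A thin majority edge $ab$ is special if in addition $ab$ is a majority edge, a congruence $\theta$ of $\mathsf{Sg}\{a,b\}$ witnesses that, and $ab$ is a minimal pair with respect to $\theta$. -}

module Defs where

open import Algebra.Lattice.Structures using (IsSemilattice)
open import Data.Fin.Base using (Fin)
open import Data.Nat.Base using (ℕ)
open import Data.Product.Base using (Σ-syntax; ∃-syntax; _×_; _,_; proj₁)
open import Data.Sum.Base using (_⊎_)
open import Data.Vec.Base using (Vec; []; _∷_; lookup; replicate)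
open import Data.Vec.Relation.Binary.Pointwise.Inductive using (Pointwise)
open import Data.Vec.Relation.Unary.All using (All)
open import Function.Base using (_on_)
open import Function.Bundles using (_↔_)
open import Level using (0ℓ)
open import Relation.Binary.Core using (Rel)
open import Relation.Binary.PropositionalEquality.Core using (_≡_; _≢_)
open import Relation.Nullary.Negation.Core using (¬_)
open import Relation.Unary using (Pred; _∈_; _∪_; ｛_｝)

record Signature : Set₁ where
  field
    Op    : Set
    arity : Op → ℕ

open Signature public

record Algebra (S : Signature) : Set₁ where
  field
    Carrier : Set
    interp  : (f : Op S) → Vec Carrier (arity S f) → Carrier

open Algebra public

data Term (S : Signature) (n : ℕ) : Set where
  var : Fin n → Term S n
  app : (f : Op S) → Vec (Term S n) (arity S f) → Term S n

module _ {S : Signature} (A : Algebra S) where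

  ⟦_⟧  : ∀ {n} → Term S n → Vec (Carrier A) n → Carrier A
  ⟦_⟧* : ∀ {n m} → Vec (Term S n) m → Vec (Carrier A) n → Vec (Carrier A) m

  ⟦ var i ⟧    xs = lookup xs i
  ⟦ app f ts ⟧ xs = interp A f (⟦ ts ⟧* xs)

  ⟦ [] ⟧*     xs = []
  ⟦ t ∷ ts ⟧* xs = ⟦ t ⟧ xs ∷ ⟦ ts ⟧* xs

  op₂ : Term S 2 → Carrier A → Carrier A → Carrier A
  op₂ t x y = ⟦ t ⟧ (x ∷ y ∷ [])

  op₃ : Term S 3 → Carrier A → Carrier A → Carrier A → Carrier A
  op₃ t x y z = ⟦ t ⟧ (x ∷ y ∷ z ∷ [])

  IsFinite : Set
  IsFinite = ∃[ n ] (Carrier A ↔ Fin n)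

  IsIdempotent : Set
  IsIdempotent = ∀ f x → interp A f (replicate (arity S f) x) ≡ x

  IsSubuniverse : Pred (Carrier A) 0ℓ → Set
  IsSubuniverse B = ∀ f {xs} → All B xs → interp A f xs ∈ B

  data Generated (X : Pred (Carrier A) 0ℓ) : Pred (Carrier A) 0ℓ where
    gen    : ∀ {x} → x ∈ X → x ∈ Generated X
    closed : ∀ f {xs} → All (Generated X) xs → interp A f xs ∈ Generated X

  Sg : Carrier A → Carrier A → Pred (Carrier A) 0ℓ
  Sg a b = Generated (｛ a ｝ ∪ ｛ b ｝)

  -- A congruence of the subalgebra with universe B, given as a subset of
  -- B × B.  Consequently the block a/θ is the predicate θ a.
  record IsCongruenceOn (B : Pred (Carrier A) 0ℓ) (θ : Rel (Carrier A) 0ℓ) : Set where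
    field
      within     : ∀ {x y} → θ x y → x ∈ B × y ∈ B
      reflexive  : ∀ {x} → x ∈ B → θ x x
      symmetric  : ∀ {x y} → θ x y → θ y x
      transitive : ∀ {x y z} → θ x y → θ y z → θ x z
      compatible : ∀ f {xs ys} → Pointwise θ xs ys → θ (interp A f xs) (interp A f ys)

IsMajority : {X : Set} → Rel X 0ℓ → (X → X → X → X) → Set
IsMajority _≈_ g = ∀ x y → (g x x y ≈ x) × (g x y x ≈ x) × (g y x x ≈ x)

module _ {S : Signature} (A : Algebra S) (a b : Carrier A) (θ : Rel (Carrier A) 0ℓ) where

  -- The two-element set {a/θ, b/θ} is represented by the setoid whose
  -- elements are those of a/θ ∪ b/θ and whose equality is θ.
  BlockPair : Set
  BlockPair = Σ[ x ∈ Carrier A ] x ∈ θ a ∪ θ b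

  _≈ᴮ_ : Rel BlockPair 0ℓ
  _≈ᴮ_ = θ on proj₁

  InducesSemilattice : Term S 2 → Set
  InducesSemilattice t =
    Σ[ preserves ∈ (∀ (x y : BlockPair) → op₂ A t (proj₁ x) (proj₁ y) ∈ θ a ∪ θ b) ]
      IsSemilattice _≈ᴮ_ (λ x y → op₂ A t (proj₁ x) (proj₁ y) , preserves x y)

  InducesMajority : Term S 3 → Set
  InducesMajority t =
    Σ[ preserves ∈ (∀ (x y z : BlockPair) →
                      op₃ A t (proj₁ x) (proj₁ y) (proj₁ z) ∈ θ a ∪ θ b) ]
      IsMajority _≈ᴮ_
        (λ x y z → op₃ A t (proj₁ x) (proj₁ y) (proj₁ z) , preserves x y z)

  record IsSemilatticeEdge : Set where
    field
      distinct    : a ≢ b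
      congruence  : IsCongruenceOn A (Sg A a b) θ
      separates   : ¬ θ a b
      semilattice : ∃[ t ] InducesSemilattice t

  record IsMajorityEdge : Set where
    field
      distinct      : a ≢ b
      congruence    : IsCongruenceOn A (Sg A a b) θ
      separates     : ¬ θ a b
      majority      : ∃[ t ] InducesMajority t
      noSemilattice : ¬ (∃[ t ] InducesSemilattice t)

  IsMinimalPair : Set
  IsMinimalPair = ∀ {b′} → b′ ∈ θ b → b ∈ Sg A a b′

IsSmooth : ∀ {S} → Algebra S → Set₁
IsSmooth A = ∀ a b θ → IsSemilatticeEdge A a b θ ⊎ IsMajorityEdge A a b θ →
             IsSubuniverse A (θ a ∪ θ b)

module _ {S : Signature} {k : ℕ} (K : Fin k → Algebra S) where

  record MajorityCondition (g : Term S 3) : Set₁ where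
    field
      identity : ∀ i x y → let g′ = op₃ (K i) g in
                 g′ x (g′ x y y) (g′ x y y) ≡ g′ x y y
      majority : ∀ i a b θ → IsMajorityEdge (K i) a b θ → InducesMajority (K i) a b θ g

  record IsThinMajorityEdge (i : Fin k) (a b : Carrier (K i)) : Set₁ where
    field
      distinct : a ≢ b
      thin     : ∀ g → MajorityCondition g → let g′ = op₃ (K i) g in
                 b ∈ Sg (K i) a (g′ a b b) ×
                 b ∈ Sg (K i) a (g′ b a b) ×
                 b ∈ Sg (K i) a (g′ b b a)

  IsSpecialThinMajorityEdge : (i : Fin k) (a b : Carrier (K i)) → Set₁
  IsSpecialThinMajorityEdge i a b =
    IsThinMajorityEdge i a b ×
    ∃[ θ ] (IsMajorityEdge (K i) a b θ × IsMinimalPair (K i) a b θ)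

{-# OPTIONS --safe #-}

-- Choose d in b/θ with Sg{c,d} minimal under inclusion, and let θ′ be the
-- restriction of θ to Sg{c,d}.  Minimality of Sg{c,d} makes cd a minimal pair
-- for θ′, and the two-element quotients on {a/θ, b/θ} and {c/θ′, d/θ′} carry
-- the same term operations, so θ′ witnesses that cd is a majority edge.  Any g′
-- satisfying the majority condition is then a majority operation on
-- {c/θ′, d/θ′}; it sends (c,d,d), (d,c,d) and (d,d,c) into d/θ′, and thinness
-- is an instance of the minimality of the pair cd.

module Submission where

open import Defs
open import Algebra.Lattice.Structures using (module IsSemilattice)
open import Axiom.ExcludedMiddle using (ExcludedMiddle)
open import Data.Fin.Base using (Fin)
open import Data.Fin.Induction using (spo-wellFounded)
open import Data.Nat.Base using (ℕ)
open import Data.Product.Base using (∃-syntax; Σ-syntax; _×_; _,_; proj₁; proj₂)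
open import Data.Sum.Base using (inj₁; inj₂)
import Data.Sum.Base as Sum
open import Data.Vec.Base using (Vec; []; _∷_)
open import Data.Vec.Relation.Binary.Pointwise.Inductive using (Pointwise; []; _∷_)
import Data.Vec.Relation.Binary.Pointwise.Inductive as Pointwise
open import Data.Vec.Relation.Unary.All using (All; []; _∷_)
open import Data.Vec.Relation.Unary.All.Properties using (lookup⁺)
open import Function.Base using (_∘_; _on_)
open import Function.Bundles using (Inverse; _↔_)
open import Induction.WellFounded using (WellFounded; Acc; acc; module Subrelation)
open import Level using (0ℓ; Lift; lift; lower) renaming (suc to lsuc)
open import Relation.Binary.Core using (Rel)
import Relation.Binary.Construct.On as On
open import Relation.Binary.Definitions using (Transitive; Irreflexive)
open import Relation.Binary.PropositionalEquality
  using (_≡_; refl; sym; subst₂; isEquivalence; resp₂)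
open import Relation.Nullary.Decidable.Core using (yes; no; map′; decidable-stable)
open import Relation.Nullary.Negation.Core using (¬_)
open import Relation.Unary using (Pred; _∈_; _⊆_; _∪_)

-- Minimal elements of preorders on finite sets.

lower-em : ExcludedMiddle (lsuc 0ℓ) → ExcludedMiddle 0ℓ
lower-em em = map′ lower lift em

module _ {X : Set} (X-finite : ∃[ n ] (X ↔ Fin n)) where

  -- The order is moved along the bijection to `Fin n`, where every strict partial order is
  -- well-founded, and pulled back through `from (to x) ≡ x`.
  finite⇒wellFounded : {_<_ : Rel X 0ℓ} →
                       Transitive _<_ → Irreflexive _≡_ _<_ → WellFounded _<_
  finite⇒wellFounded {_<_} <-trans <-irrefl =
    Subrelation.wellFounded
      (subst₂ _<_ (sym (strictlyInverseʳ _)) (sym (strictlyInverseʳ _)))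
      (On.wellFounded to (spo-wellFounded {_⊏_ = _<_ on from} record
        { isEquivalence = isEquivalence
        ; irrefl        = λ { refl → <-irrefl refl }
        ; trans         = <-trans
        ; <-resp-≈      = resp₂ _
        }))
    where open Inverse (proj₂ X-finite)

  -- Descend along the strict part of `_≤_`, asking at each stage whether `P` still has a strictly
  -- smaller element. Minimality has the preorder form because distinct `d` may generate the same
  -- `Sg A c d`.
  finite⇒minimal : ExcludedMiddle 0ℓ → {_≤_ : Rel X 0ℓ} → Transitive _≤_ →
                   (P : Pred X 0ℓ) → ∀ {x} → x ∈ P →
                   ∃[ m ] (m ∈ P × (∀ {y} → y ∈ P → y ≤ m → m ≤ y))
  finite⇒minimal em {_≤_} ≤-trans P = descend (<-wellFounded _)
    where
    _<_ : Rel X 0ℓ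
    x < y = x ≤ y × ¬ (y ≤ x)

    <-wellFounded : WellFounded _<_
    <-wellFounded = finite⇒wellFounded
      (λ { (x≤y , y≰x) (y≤z , _) → ≤-trans x≤y y≤z , λ z≤x → y≰x (≤-trans y≤z z≤x) })
      (λ { refl (x≤x , x≰x) → x≰x x≤x })

    descend : ∀ {x} → Acc _<_ x → x ∈ P →
              ∃[ m ] (m ∈ P × (∀ {y} → y ∈ P → y ≤ m → m ≤ y))
    descend {x} (acc rs) x∈P with em {∃[ y ] (y ∈ P × y < x)}
    ... | yes (y , y∈P , y<x) = descend (rs y<x) y∈P
    -- With `y ≤ x`, a failure of `x ≤ y` would make `y` strictly smaller, so `x ≤ y` holds up to
    -- double negation.
    ... | no  ∄y<x            = x , x∈P , λ y∈P y≤x →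
      decidable-stable em (λ x≰y → ∄y<x (_ , y∈P , y≤x , x≰y))

-- Generated subuniverses, term operations and congruences.

module _ {S : Signature} (A : Algebra S) where

  -- Induction on generation; the companion for argument vectors keeps the recursion structural.
  Generated-least : {X B : Pred (Carrier A) 0ℓ} → IsSubuniverse A B →
                    X ⊆ B → Generated A X ⊆ B
  Generated-least* : {X B : Pred (Carrier A) 0ℓ} → IsSubuniverse A B → X ⊆ B →
                     ∀ {n} {xs : Vec (Carrier A) n} → All (Generated A X) xs → All B xs

  Generated-least B-sub X⊆B (gen x∈X)      = X⊆B x∈X
  Generated-least B-sub X⊆B (closed f xs∈) = B-sub f (Generated-least* B-sub X⊆B xs∈)

  Generated-least* B-sub X⊆B []         = []
  Generated-least* B-sub X⊆B (x∈ ∷ xs∈) =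
    Generated-least B-sub X⊆B x∈ ∷ Generated-least* B-sub X⊆B xs∈

  Sgˡ : ∀ {a b} → a ∈ Sg A a b
  Sgˡ = gen (inj₁ refl)

  Sgʳ : ∀ {a b} → b ∈ Sg A a b
  Sgʳ = gen (inj₂ refl)

  Sg-least : ∀ {a b} {B : Pred (Carrier A) 0ℓ} → IsSubuniverse A B →
             a ∈ B → b ∈ B → Sg A a b ⊆ B
  Sg-least B-sub a∈B b∈B =
    Generated-least B-sub λ { (inj₁ refl) → a∈B ; (inj₂ refl) → b∈B }

  term-closed : {B : Pred (Carrier A) 0ℓ} → IsSubuniverse A B →
                ∀ {n} (t : Term S n) {xs} → All B xs → ⟦_⟧ A t xs ∈ B
  term-closed* : {B : Pred (Carrier A) 0ℓ} → IsSubuniverse A B →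
                 ∀ {n m} (ts : Vec (Term S n) m) {xs} → All B xs → All B (⟦_⟧* A ts xs)

  term-closed B-sub (var i)    xs∈ = lookup⁺ xs∈ i
  term-closed B-sub (app f ts) xs∈ = B-sub f (term-closed* B-sub ts xs∈)

  term-closed* B-sub []       xs∈ = []
  term-closed* B-sub (t ∷ ts) xs∈ = term-closed B-sub t xs∈ ∷ term-closed* B-sub ts xs∈

  module _ {B : Pred (Carrier A) 0ℓ} {θ : Rel (Carrier A) 0ℓ}
           (θ-cong : IsCongruenceOn A B θ) where
    open IsCongruenceOn θ-cong

    term-compatible : ∀ {n} (t : Term S n) {xs ys} → Pointwise θ xs ys →
                      θ (⟦_⟧ A t xs) (⟦_⟧ A t ys)
    term-compatible* : ∀ {n m} (ts : Vec (Term S n) m) {xs ys} → Pointwise θ xs ys →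
                       Pointwise θ (⟦_⟧* A ts xs) (⟦_⟧* A ts ys)

    term-compatible (var i)    xs≈ys = Pointwise.lookup xs≈ys i
    term-compatible (app f ts) xs≈ys = compatible f (term-compatible* ts xs≈ys)

    term-compatible* []       xs≈ys = []
    term-compatible* (t ∷ ts) xs≈ys = term-compatible t xs≈ys ∷ term-compatible* ts xs≈ys

  -- Restricting a congruence and transferring majority edges.

  Restrict : Pred (Carrier A) 0ℓ → Rel (Carrier A) 0ℓ → Rel (Carrier A) 0ℓ
  Restrict C θ x y = θ x y × x ∈ C × y ∈ C

  Restrict-congruence : {B C : Pred (Carrier A) 0ℓ} {θ : Rel (Carrier A) 0ℓ} →
                        IsSubuniverse A C → C ⊆ B →
                        IsCongruenceOn A B θ → IsCongruenceOn A C (Restrict C θ)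
  Restrict-congruence {C = C} {θ} C-sub C⊆B θ-cong = record
    { within     = proj₂
    ; reflexive  = λ x∈C → θ-reflexive (C⊆B x∈C) , x∈C , x∈C
    ; symmetric  = λ (x≈y , x∈C , y∈C) → θ-symmetric x≈y , y∈C , x∈C
    ; transitive = λ (x≈y , x∈C , _) (y≈z , _ , z∈C) → θ-transitive x≈y y≈z , x∈C , z∈C
    ; compatible = λ f xs≈ys →
        let xs≈ys′ , xs∈C , ys∈C = split xs≈ys
        in θ-compatible f xs≈ys′ , C-sub f xs∈C , C-sub f ys∈C
    }
    where
    open IsCongruenceOn θ-cong renaming
      ( reflexive to θ-reflexive ; symmetric to θ-symmetric
      ; transitive to θ-transitive ; compatible to θ-compatible )

    split : ∀ {n} {xs ys : Vec (Carrier A) n} → Pointwise (Restrict C θ) xs ys →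
            Pointwise θ xs ys × All C xs × All C ys
    split []                          = [] , [] , []
    split ((x≈y , x∈C , y∈C) ∷ xs≈ys) =
      let xs≈ys′ , xs∈C , ys∈C = split xs≈ys
      in x≈y ∷ xs≈ys′ , x∈C ∷ xs∈C , y∈C ∷ ys∈C

  module _ {a b : Carrier A} {θ : Rel (Carrier A) 0ℓ} (θ-cong : IsCongruenceOn A (Sg A a b) θ)
           {c d : Carrier A} (a≈c : θ a c) (b≈d : θ b d) where
    open IsCongruenceOn θ-cong

    private
      θ′ : Rel (Carrier A) 0ℓ
      θ′ = Restrict (Sg A c d) θ

    Sg-⊆ : Sg A c d ⊆ Sg A a b
    Sg-⊆ = Sg-least closed (proj₂ (within a≈c)) (proj₂ (within b≈d))

    Sg-Restrict-congruence : IsCongruenceOn A (Sg A c d) θ′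
    Sg-Restrict-congruence = Restrict-congruence closed Sg-⊆ θ-cong

    private
      module θ′ = IsCongruenceOn Sg-Restrict-congruence

      -- Since `c` lies in `a/θ` and `d` in `b/θ`, the blocks of `c` and `d` under `θ′` are the
      -- traces of `a/θ` and `b/θ` on `Sg A c d`; `expand` and `shrink` are the two inclusions.
      expand : ∀ {x} → x ∈ θ′ c ∪ θ′ d → x ∈ θ a ∪ θ b
      expand = Sum.map (transitive a≈c ∘ proj₁) (transitive b≈d ∘ proj₁)

      shrink : ∀ {x} → x ∈ Sg A c d → x ∈ θ a ∪ θ b → x ∈ θ′ c ∪ θ′ d
      shrink x∈ = Sum.map (λ a≈x → transitive (symmetric a≈c) a≈x , Sgˡ , x∈)
                          (λ b≈x → transitive (symmetric b≈d) b≈x , Sgʳ , x∈)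

      ∈Sg : ∀ {x} → x ∈ θ′ c ∪ θ′ d → x ∈ Sg A c d
      ∈Sg (inj₁ (_ , _ , x∈)) = x∈
      ∈Sg (inj₂ (_ , _ , x∈)) = x∈

      blocks-resp : ∀ {x y} → θ x y → x ∈ θ a ∪ θ b → y ∈ θ a ∪ θ b
      blocks-resp x≈y = Sum.map (λ a≈x → transitive a≈x x≈y) (λ b≈x → transitive b≈x x≈y)

      -- Both blocks of `θ` meet `Sg A c d`, in `c` and in `d`. This is what lets facts about `θ′`
      -- be carried back up to `θ`.
      representative : (x : BlockPair A a b θ) →
                       Σ[ r ∈ BlockPair A c d θ′ ] θ (proj₁ x) (proj₁ r)
      representative (x , inj₁ a≈x) =
        (c , inj₁ (θ′.reflexive Sgˡ)) , transitive (symmetric a≈x) a≈c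
      representative (x , inj₂ b≈x) =
        (d , inj₂ (θ′.reflexive Sgʳ)) , transitive (symmetric b≈x) b≈d

    -- The laws are inherited by smaller blocks; what must be added is that the values stay in
    -- `Sg A c d`, which holds since subuniverses are closed under term operations.
    Restrict-majority : ∀ {g} → InducesMajority A a b θ g → InducesMajority A c d θ′ g
    Restrict-majority {g} (preserves , majority) =
        (λ (x , x∈) (y , y∈) (z , z∈) →
          shrink (g-closed (∈Sg x∈) (∈Sg y∈) (∈Sg z∈))
                 (preserves (x , expand x∈) (y , expand y∈) (z , expand z∈)))
      , λ (x , x∈) (y , y∈) →
          let xxy , xyx , yxx = majority (x , expand x∈) (y , expand y∈)
              x∈Sg = ∈Sg x∈
              y∈Sg = ∈Sg y∈
          in (xxy , g-closed x∈Sg x∈Sg y∈Sg , x∈Sg)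
           , (xyx , g-closed x∈Sg y∈Sg x∈Sg , x∈Sg)
           , (yxx , g-closed y∈Sg x∈Sg x∈Sg , x∈Sg)
      where
      g-closed : ∀ {x y z} → x ∈ Sg A c d → y ∈ Sg A c d → z ∈ Sg A c d →
                 op₃ A g x y z ∈ Sg A c d
      g-closed x∈ y∈ z∈ = term-closed closed g (x∈ ∷ y∈ ∷ z∈ ∷ [])

    -- Every law is checked on representatives taken from {c, d}, where it is
    -- the corresponding law modulo θ′.
    extend-semilattice : ∀ {t} → InducesSemilattice A c d θ′ t → InducesSemilattice A a b θ t
    extend-semilattice {t} (preserves , semilattice) = preserves⁺ , record
      { isBand = record
        { isSemigroup = record
          { isMagma = record
            { isEquivalence = record
              { refl  = λ {x} → reflexive (x∈Sg x)
              ; sym   = symmetric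
              ; trans = transitive
              }
            ; ∙-cong = t-cong
            }
          ; assoc = λ x y z →
              let r , x≈r = representative x
                  s , y≈s = representative y
                  u , z≈u = representative z
              in transport (t-cong (t-cong x≈r y≈s) z≈u) (t-cong x≈r (t-cong y≈s z≈u))
                           (proj₁ (assoc r s u))
          }
        ; idem = λ x →
            let r , x≈r = representative x
            in transport (t-cong x≈r x≈r) x≈r (proj₁ (idem r))
        }
      ; comm = λ x y →
          let r , x≈r = representative x
              s , y≈s = representative y
          in transport (t-cong x≈r y≈s) (t-cong y≈s x≈r) (proj₁ (comm r s))
      }
      where
      open IsSemilattice (_≈ᴮ_ A c d θ′) semilattice using (assoc; idem; comm)

      t-cong : ∀ {x y u v} → θ x y → θ u v → θ (op₂ A t x u) (op₂ A t y v)
      t-cong x≈y u≈v = term-compatible θ-cong t (x≈y ∷ u≈v ∷ [])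

      transport : ∀ {x y u v} → θ x u → θ y v → θ u v → θ x y
      transport x≈u y≈v u≈v = transitive x≈u (transitive u≈v (symmetric y≈v))

      x∈Sg : (x : BlockPair A a b θ) → proj₁ x ∈ Sg A a b
      x∈Sg (_ , inj₁ a≈x) = proj₂ (within a≈x)
      x∈Sg (_ , inj₂ b≈x) = proj₂ (within b≈x)

      preserves⁺ : (x y : BlockPair A a b θ) → op₂ A t (proj₁ x) (proj₁ y) ∈ θ a ∪ θ b
      preserves⁺ x y =
        let r , x≈r = representative x
            s , y≈s = representative y
        in blocks-resp (symmetric (t-cong x≈r y≈s)) (expand (preserves r s))

  Restrict-majorityEdge : ∀ {a b c d θ} → IsMajorityEdge A a b θ → θ a c → θ b d →
                          IsMajorityEdge A c d (Restrict (Sg A c d) θ)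
  Restrict-majorityEdge {a} {b} {c} {d} {θ} edge a≈c b≈d = record
    { distinct      = λ { refl → c≉d (reflexive (proj₂ (within a≈c))) }
    ; congruence    = Sg-Restrict-congruence congruence a≈c b≈d
    ; separates     = c≉d ∘ proj₁
    ; majority      = let g , g-maj = majority
                      in g , Restrict-majority congruence a≈c b≈d {g} g-maj
    -- Non-existence needs the opposite direction: a semilattice term for `cd` would already be one
    -- for `ab`.
    ; noSemilattice = λ (t , t-semi) →
        noSemilattice (t , extend-semilattice congruence a≈c b≈d {t} t-semi)
    }
    where
    open IsMajorityEdge edge
    open IsCongruenceOn congruence
    c≉d : ¬ θ c d
    c≉d c≈d = separates (transitive a≈c (transitive c≈d (symmetric b≈d)))

-- Thinness from minimality, and the choice of `d`.

-- The majority condition applies to this very edge, so any arrangement of two `b` and one `a` is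
-- sent into `b/θ`, and minimality recovers `b` from `a` and that value.
minimalMajorityEdge⇒thin :
  ∀ {S : Signature} {k : ℕ} (K : Fin k → Algebra S) {i : Fin k} {a b θ} →
  IsMajorityEdge (K i) a b θ → IsMinimalPair (K i) a b θ → IsThinMajorityEdge K i a b
minimalMajorityEdge⇒thin K {i} {a} {b} {θ} edge b-minimal = record
  { distinct = distinct
  ; thin     = λ g g-cond →
      let a∈ = a , inj₁ (reflexive (Sgˡ (K i)))
          b∈ = b , inj₂ (reflexive (Sgʳ (K i)))
          -- Here `b` is the repeated argument, and the laws arrive in the reverse of the order that
          -- `thin` lists them.
          bba , bab , abb = proj₂ (MajorityCondition.majority g-cond i a b θ edge) b∈ a∈
      in b-minimal (symmetric abb) , b-minimal (symmetric bab) , b-minimal (symmetric bba)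
  }
  where
  open IsMajorityEdge edge
  open IsCongruenceOn congruence

corollary4p7 : ExcludedMiddle (lsuc 0ℓ) →
    (S : Signature) (k : ℕ) (K : Fin k → Algebra S) →
    (∀ i → IsFinite (K i)) →
    (∀ i → IsIdempotent (K i)) →
    (∀ i → IsSmooth (K i)) →
    (i : Fin k) (a b : Carrier (K i)) (θ : Rel (Carrier (K i)) 0ℓ) →
    IsMajorityEdge (K i) a b θ →
    (c : Carrier (K i)) → c ∈ θ a →
    ∃[ d ] (d ∈ θ b × IsSpecialThinMajorityEdge K i c d)
corollary4p7 em S k K finite _ _ i a b θ edge c a≈c =
  d , b≈d , minimalMajorityEdge⇒thin K edge′ d-minimal′ , _ , edge′ , d-minimal′
  where
  A = K i
  open IsMajorityEdge edge
  open IsCongruenceOn congruence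

  smallest : ∃[ d ] (d ∈ θ b × (∀ {y} → y ∈ θ b → y ∈ Sg A c d → d ∈ Sg A c y))
  -- The preorder puts `x` below `y` when `x ∈ Sg A c y`, that is, when `Sg A c x ⊆ Sg A c y`; the
  -- descent starts at `b`.
  smallest = finite⇒minimal (finite i) (lower-em em)
    (λ x∈Sg[c,y] y∈Sg[c,z] → Sg-least A closed (Sgˡ A) y∈Sg[c,z] x∈Sg[c,y])
    (θ b) (reflexive (Sgʳ A))

  d = proj₁ smallest
  b≈d = proj₁ (proj₂ smallest)

  edge′ : IsMajorityEdge A c d (Restrict A (Sg A c d) θ)
  edge′ = Restrict-majorityEdge A edge a≈c b≈d

  d-minimal′ : IsMinimalPair A c d (Restrict A (Sg A c d) θ)
  -- The membership clause of `Restrict` supplies `y ∈ Sg A c d`, so `y` is below `d` in the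
  -- preorder and minimality of `d` applies.
  d-minimal′ (d≈y , _ , y∈Sg) = proj₂ (proj₂ smallest) (transitive b≈d d≈y) y∈Sg
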